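{- There is a polynomial-time reduction from 3-Coloring to Fall 3-Coloring: there is a polynomial-time algorithm that, given a graph $G$, outputs a graph $G'$ such that $G$ has a proper vertex $3$-coloring if and only if $G'$ admits a fall $3$-coloring.
   Context: All graphs are finite and undirected. 3-Coloring: given a graph $G$, decide whether there is a map $c:V(G)\to\{1,2,3\}$ with $c(u)\neq c(v)$ for every edge $uv$. For a graph $G=(V,E)$ and a partition $\Pi=\{V_1,\dots,V_k\}$ of $V$, a vertex $v\in V_i$ is colorful if $v$ is adjacent to at least one vertex of each class $V_j$ with $j\neq i$; $\Pi$ is a fall $k$-coloring if every $V_i$ is independent and every vertex is colorful (equivalently, $V$ is partitioned into $k$ independent dominating sets). Fall 3-Coloring: given a graph, decide whether it admits a fall $3$-coloring. -}

module Defs where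

open import Data.Nat using (ℕ; zero; suc; _+_; _*_; _^_; _≤_)
open import Data.Fin using (Fin; zero; suc)
open import Data.Bool using (Bool; true; false)
open import Data.List using (List; []; _∷_; _++_; replicate; concat; tabulate; map; length)
open import Data.Maybe using (Maybe; just; nothing)
open import Data.Product using (Σ; ∃; _×_; _,_)
open import Relation.Binary.PropositionalEquality using (_≡_; _≢_)
open import Relation.Nullary using (¬_)

record Graph : Set where
  field
    n     : ℕ
    adj   : Fin n → Fin n → Bool
    sym   : ∀ u v → adj u v ≡ adj v u
    loopless : ∀ v → adj v v ≡ false
open Graph public

ThreeColorable : Graph → Set
ThreeColorable G =
  Σ (Fin (n G) → Fin 3) λ c → ∀ u v → adj G u v ≡ true → c u ≢ c v

-- fall 3-coloring: partition V into three (nonempty) classes V₁,V₂,V₃,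
-- given as the class map c; every class independent, every vertex colorful.
IsFall3Coloring : (G : Graph) → (Fin (n G) → Fin 3) → Set
IsFall3Coloring G c =
    (∀ i → ∃ λ v → c v ≡ i)
  × (∀ u v → adj G u v ≡ true → c u ≢ c v)
  × (∀ v j → j ≢ c v → ∃ λ u → adj G v u ≡ true × c u ≡ j)

Fall3Colorable : Graph → Set
Fall3Colorable G = Σ (Fin (n G) → Fin 3) (IsFall3Coloring G)

encode : Graph → List Bool
encode G = replicate (n G) true ++ (false ∷ concat (tabulate λ i → tabulate λ j → adj G i j))

-- Deterministic single-tape Turing machines.
-- Tape alphabet Fin (3 + s): symbol 0 = blank, 1 = bit false, 2 = bit true.

data Move : Set where
  L R S : Move

record TM : Set where
  field
    Q      : ℕ
    s      : ℕ
    start  : Fin Q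
    δ      : Fin Q → Fin (3 + s) → Maybe (Fin Q × Fin (3 + s) × Move)  -- nothing = halt

module _ (M : TM) where
  open TM M

  Sym : Set
  Sym = Fin (3 + s)

  blank : Sym
  blank = zero

  bitSym : Bool → Sym
  bitSym false = suc zero
  bitSym true  = suc (suc zero)

  -- configuration: state, tape left of head (nearest first), scanned symbol, tape right of head
  record Config : Set where
    constructor conf
    field
      state : Fin Q
      left  : List Sym
      cur   : Sym
      right : List Sym

  moveHead : Fin Q → Move → List Sym → Sym → List Sym → Config
  moveHead q S l c r = conf q l c r
  moveHead q L []      c r = conf q [] blank (c ∷ r)
  moveHead q L (x ∷ l) c r = conf q l x (c ∷ r)
  moveHead q R l c []      = conf q (c ∷ l) blank []
  moveHead q R l c (x ∷ r) = conf q (c ∷ l) x r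

  step : Config → Maybe Config
  step (conf q l c r) with δ q c
  ... | nothing = nothing
  ... | just (q' , c' , m) = just (moveHead q' m l c' r)

  run : ℕ → Config → Maybe Config
  run zero    k = just k
  run (suc t) k with step k
  ... | nothing = nothing
  ... | just k' = run t k'

  initial : List Bool → Config
  initial []      = conf start [] blank []
  initial (b ∷ w) = conf start [] (bitSym b) (map bitSym w)

  nonBlankPrefix : List Sym → List Sym
  nonBlankPrefix [] = []
  nonBlankPrefix (zero ∷ xs) = []
  nonBlankPrefix (suc x ∷ xs) = suc x ∷ nonBlankPrefix xs

  output : Config → List Sym
  output (conf q l c r) = nonBlankPrefix (c ∷ r)

  HaltsWith : List Bool → ℕ → List Bool → Set
  HaltsWith w t v = ∃ λ k → run t (initial w) ≡ just k × step k ≡ nothing × output k ≡ map bitSym v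

module Submission where

-- The reduction maps G to its prism G □ K₃: each vertex v becomes a
-- triangle (v , 0), (v , 1), (v , 2), and (v , i) ~ (w , i) for every edge
-- vw of G.  A proper 3-colouring c of G yields the fall 3-colouring
-- (v , i) ↦ c v + i (mod 3): every triangle carries all three colours, so
-- every vertex is colourful, and layer 0 of any proper colouring of the
-- prism properly colours G.  The graph without vertices is mapped to K₃.

open import Defs hiding (sym)
open import Data.Nat using (ℕ; zero; suc; _+_; _*_; _∸_; _^_; _≤_; z≤n; s≤s)
open import Data.Nat.Properties hiding (_≟_)
open import Data.Nat.DivMod using (m%n<n)
open import Data.Fin as F using (Fin; zero; suc; toℕ)
import Data.Vec as Vec
open import Data.Vec using (Vec; []; _∷_)
open import Data.Fin.Properties using (all?; any?; _≟_; remQuot-combine; splitAt-join; 2↔Bool)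
open import Data.Bool using (Bool; true; false; not; _∧_; if_then_else_)
open import Data.Bool.Properties using (∧-identityʳ; not-¬)
open import Data.List using (List; []; _∷_; _++_; _ʳ++_; [_]; map; reverse; length; tabulate; replicate; concat)
open import Data.List.Properties
open import Data.List.Relation.Unary.All as All using (All; []; _∷_)
open import Data.List.Relation.Unary.All.Properties using (++⁺; ++⁻ˡ; map⁺; replicate⁺; tabulate⁺)
open import Data.Nat.Tactic.RingSolver using (solve-∀)
open import Data.Maybe as Maybe using (Maybe; just; nothing; _>>=_)
open import Data.Product as Prod using (Σ; ∃; _×_; _,_)
open import Data.Sum as Sum using (_⊎_; inj₁; inj₂)
open import Function.Bundles using (Inverse)
open import Data.Empty using (⊥; ⊥-elim)
open import Relation.Binary.PropositionalEquality hiding ([_])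
open import Relation.Nullary using (Dec; yes; no; does)
open import Relation.Nullary.Decidable using (from-yes; _→-dec_; dec-true; dec-false)

_==_ : ∀ {m} → Fin m → Fin m → Bool
i == j = does (i ≟ j)

==-refl : ∀ {m} (i : Fin m) → (i == i) ≡ true
==-refl i = dec-true (i ≟ i) refl

==-sym : ∀ {m} (i j : Fin m) → (i == j) ≡ (j == i)
==-sym i j with i ≟ j | j ≟ i
... | yes _  | yes _  = refl
... | no _   | no _   = refl
... | yes eq | no neq = ⊥-elim (neq (sym eq))
... | no neq | yes eq = ⊥-elim (neq (sym eq))

-- Colours Fin 3 with addition modulo 3.  Its table is a latin square
-- (rows and columns are permutations); the three facts used are decided by
-- evaluation over the nine entries.
_⊕_ : Fin 3 → Fin 3 → Fin 3
a ⊕ i = F.fromℕ< (m%n<n (toℕ a + toℕ i) 3)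

⊕-cancelˡ : ∀ a i j → a ⊕ i ≡ a ⊕ j → i ≡ j
⊕-cancelˡ = from-yes (all? λ a → all? λ i → all? λ j → (a ⊕ i ≟ a ⊕ j) →-dec (i ≟ j))

⊕-cancelʳ : ∀ a b i → a ⊕ i ≡ b ⊕ i → a ≡ b
⊕-cancelʳ = from-yes (all? λ a → all? λ b → all? λ i → (a ⊕ i ≟ b ⊕ i) →-dec (a ≟ b))

⊕-solve : ∀ a k → ∃ λ i → a ⊕ i ≡ k
⊕-solve = from-yes (all? λ a → all? λ k → any? λ i → a ⊕ i ≟ k)

-- Vertex
-- (v , i) is adjacent to (v , j) for j ≢ i (a triangle per vertex of G)
-- and to (w , i) for every neighbour w of v.  prismBit i d b j is the
-- adjacency bit of (v , i) and (w , j) when d = (v == w), b = adj G v w.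
prismBit : Fin 3 → Bool → Bool → Fin 3 → Bool
prismBit i d b j = if d then not (i == j) else (b ∧ (i == j))

prismAdj : (G : Graph) → Fin (n G) × Fin 3 → Fin (n G) × Fin 3 → Bool
prismAdj G (v , i) (w , j) = prismBit i (v == w) (adj G v w) j

prismAdj-sym : ∀ G x y → prismAdj G x y ≡ prismAdj G y x
prismAdj-sym G (v , i) (w , j) rewrite ==-sym v w | ==-sym i j | Graph.sym G v w = refl

prismAdj-loop : ∀ G x → prismAdj G x x ≡ false
prismAdj-loop G (v , i) rewrite ==-refl v | ==-refl i = refl

-- Vertices of the prism are Fin (n G * 3), (v , i) being combine v i.
prism : Graph → Graph
prism G = record
  { n        = n G * 3
  ; adj      = λ p q → prismAdj G (F.remQuot 3 p) (F.remQuot 3 q)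
  ; sym      = λ p q → prismAdj-sym G (F.remQuot 3 p) (F.remQuot 3 q)
  ; loopless = λ p → prismAdj-loop G (F.remQuot 3 p)
  }

prism-adj : ∀ G v i w j → adj (prism G) (F.combine v i) (F.combine w j) ≡ prismAdj G (v , i) (w , j)
prism-adj G v i w j = cong₂ (prismAdj G) (remQuot-combine v i) (remQuot-combine w j)

triangle-edge : ∀ G v i j → i ≢ j → prismAdj G (v , i) (v , j) ≡ true
triangle-edge G v i j i≢j rewrite ==-refl v | dec-false (i ≟ j) i≢j = refl

prism-edge : ∀ G u v i → u ≢ v → prismAdj G (u , i) (v , i) ≡ adj G u v
prism-edge G u v i u≢v rewrite dec-false (u ≟ v) u≢v | ==-refl i = ∧-identityʳ (adj G u v)

triangle-edge⇒≢ : ∀ G v i j → prismAdj G (v , i) (v , j) ≡ true → i ≢ j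
triangle-edge⇒≢ G v i .i e refl rewrite ==-refl v | ==-refl i = not-¬ refl (sym e)

cross-edge⇒edge : ∀ G u v i j → u ≢ v → prismAdj G (u , i) (v , j) ≡ true → adj G u v ≡ true × i ≡ j
cross-edge⇒edge G u v i j u≢v e rewrite dec-false (u ≟ v) u≢v with adj G u v | i ≟ j
... | true  | yes i≡j = refl , i≡j
... | true  | no _    = ⊥-elim (not-¬ refl (sym e))
... | false | _       = ⊥-elim (not-¬ refl (sym e))

-- Colouring vertex (v , i) by c v ⊕ i turns a proper 3-colouring of G
-- into a fall 3-colouring of the prism; nonempty classes need a vertex.
module Shifted (G : Graph) (c : Fin (n G) → Fin 3) (proper : ∀ u v → adj G u v ≡ true → c u ≢ c v) where
  shifted : Fin (n G) × Fin 3 → Fin 3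
  shifted (v , i) = c v ⊕ i

  independent : ∀ x y → prismAdj G x y ≡ true → shifted x ≢ shifted y
  independent (v , i) (w , j) e same = by-cases (v ≟ w)
    where
    by-cases : Dec (v ≡ w) → ⊥
    by-cases (yes refl) = triangle-edge⇒≢ G v i j e (⊕-cancelˡ (c v) i j same)
    by-cases (no v≢w) with cross-edge⇒edge G v w i j v≢w e
    ... | edge , refl = proper v w edge (⊕-cancelʳ (c v) (c w) i same)

  -- The k-coloured neighbour of (v , i) lies in the triangle of v.
  colorful : ∀ x k → k ≢ shifted x → ∃ λ y → prismAdj G x y ≡ true × shifted y ≡ k
  colorful (v , i) k k≢ with ⊕-solve (c v) k
  ... | j , cvj≡k = (v , j) , triangle-edge G v i j i≢j , cvj≡k
    where
    i≢j : i ≢ j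
    i≢j refl = k≢ (sym cvj≡k)

3col⇒fall : ∀ G → Fin (n G) → ThreeColorable G → Fall3Colorable (prism G)
3col⇒fall G v₀ (c , proper) = colour , nonempty , independent′ , colorful′
  where
  open Shifted G c proper
  colour : Fin (n G * 3) → Fin 3
  colour p = shifted (F.remQuot 3 p)
  at : ∀ v i → colour (F.combine v i) ≡ shifted (v , i)
  at v i = cong shifted (remQuot-combine v i)
  nonempty : ∀ k → ∃ λ p → colour p ≡ k
  nonempty k with ⊕-solve (c v₀) k
  ... | i , cvi≡k = F.combine v₀ i , trans (at v₀ i) cvi≡k
  independent′ : ∀ p q → adj (prism G) p q ≡ true → colour p ≢ colour q
  independent′ p q = independent (F.remQuot 3 p) (F.remQuot 3 q)
  colorful′ : ∀ p k → k ≢ colour p → ∃ λ q → adj (prism G) p q ≡ true × colour q ≡ k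
  colorful′ p k k≢ with colorful (F.remQuot 3 p) k k≢
  ... | (w , j) , e , cw≡k =
    F.combine w j , subst (λ y → prismAdj G (F.remQuot 3 p) y ≡ true) (sym (remQuot-combine w j)) e , trans (at w j) cw≡k

-- Conversely, layer 0 of a fall 3-colouring (even of any proper
-- colouring) of the prism properly colours G.
fall⇒3col : ∀ G → Fall3Colorable (prism G) → ThreeColorable G
fall⇒3col G (colour , _ , independent , _) = c , proper
  where
  c : Fin (n G) → Fin 3
  c v = colour (F.combine v zero)
  proper : ∀ u v → adj G u v ≡ true → c u ≢ c v
  proper u v e = independent (F.combine u zero) (F.combine v zero)
    (trans (prism-adj G u zero v zero) (trans (prism-edge G u v zero u≢v) e))
    where
    u≢v : u ≢ v
    u≢v refl = not-¬ refl (trans (sym e) (Graph.loopless G u))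

K₃ : Graph
K₃ = record
  { n        = 3
  ; adj      = λ i j → not (i == j)
  ; sym      = λ i j → cong not (==-sym i j)
  ; loopless = λ i → cong not (==-refl i)
  }

K₃-fall : Fall3Colorable K₃
K₃-fall = (λ i → i) , (λ i → i , refl) , independent , colorful
  where
  independent : ∀ u v → adj K₃ u v ≡ true → u ≢ v
  independent u .u e refl = not-¬ refl (trans (sym e) (cong not (==-refl u)))
  colorful : ∀ v j → j ≢ v → ∃ λ u → adj K₃ v u ≡ true × u ≡ j
  colorful v j j≢v = j , cong not (dec-false (v ≟ j) (λ v≡j → j≢v (sym v≡j))) , refl

record Finite (A : Set) : Set where
  field
    card          : ℕ
    index         : A → Fin card
    element       : Fin card → A
    element-index : ∀ a → element (index a) ≡ a
open Finite

finite-Fin : ∀ k → Finite (Fin k)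
finite-Fin k = record { card = k ; index = λ i → i ; element = λ i → i ; element-index = λ _ → refl }

finite-Bool : Finite Bool
finite-Bool = record
  { card = 2 ; index = Inverse.from 2↔Bool ; element = Inverse.to 2↔Bool
  ; element-index = Inverse.strictlyInverseˡ 2↔Bool }

finite-⊎ : ∀ {A B} → Finite A → Finite B → Finite (A ⊎ B)
finite-⊎ FA FB = record
  { card = card FA + card FB
  ; index = λ x → F.join (card FA) (card FB) (Sum.map (index FA) (index FB) x)
  ; element = λ i → Sum.map (element FA) (element FB) (F.splitAt (card FA) i)
  ; element-index = λ x → trans (cong (Sum.map (element FA) (element FB)) (splitAt-join (card FA) (card FB) (Sum.map (index FA) (index FB) x))) (back x) }
  where
  back : ∀ x → Sum.map (element FA) (element FB) (Sum.map (index FA) (index FB) x) ≡ x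
  back (inj₁ a) = cong inj₁ (element-index FA a)
  back (inj₂ b) = cong inj₂ (element-index FB b)

finite-× : ∀ {A B} → Finite A → Finite B → Finite (A × B)
finite-× FA FB = record
  { card = card FA * card FB
  ; index = λ (a , b) → F.combine (index FA a) (index FB b)
  ; element = λ i → Prod.map (element FA) (element FB) (F.remQuot (card FB) i)
  ; element-index = λ (a , b) → trans (cong (Prod.map (element FA) (element FB)) (remQuot-combine (index FA a) (index FB b)))
                                        (cong₂ _,_ (element-index FA a) (element-index FB b)) }

finite-retract : ∀ {A B} → Finite B → (f : A → B) (g : B → A) → (∀ a → g (f a) ≡ a) → Finite A
finite-retract FB f g gf = record
  { card = card FB ; index = λ a → index FB (f a) ; element = λ i → g (element FB i)
  ; element-index = λ a → trans (cong g (element-index FB (f a))) (gf a) }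

-- Time is measured against the
-- final configuration: `Reach a b k` says that b is reached from a in at
-- most k · (size b + 1) steps.  Since the tape never shrinks, such bounds
-- compose additively in k.
module Runs (M : TM) where
  open TM M using (δ)

  Cfg : Set
  Cfg = Config M

  -- number of visited tape cells besides the scanned one
  size : Cfg → ℕ
  size (conf q l c r) = length l + length r

  apply : Maybe (Fin (TM.Q M) × Sym M × Move) → List (Sym M) → Sym M → List (Sym M) → Maybe Cfg
  apply nothing             l c r = nothing
  apply (just (q , c′ , m)) l c r = just (moveHead M q m l c′ r)

  step-apply : ∀ q l c r → step M (conf q l c r) ≡ apply (δ q c) l c r
  step-apply q l c r with δ q c
  ... | nothing = refl
  ... | just _  = refl

  run-suc : ∀ t a → run M (suc t) a ≡ (step M a >>= run M t)
  run-suc t a with step M a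
  ... | nothing = refl
  ... | just _  = refl

  apply-size : ∀ e q l c r b → apply e l c r ≡ just b → size (conf q l c r) ≤ size b
  apply-size nothing            q l       c r       b ()
  apply-size (just (_ , _ , S)) q l       c r       b refl = ≤-refl
  apply-size (just (_ , _ , L)) q []      c r       b refl = n≤1+n _
  apply-size (just (_ , _ , L)) q (x ∷ l) c r       b refl = ≤-reflexive (sym (+-suc (length l) (length r)))
  apply-size (just (_ , _ , R)) q l       c []      b refl = n≤1+n _
  apply-size (just (_ , _ , R)) q l       c (x ∷ r) b refl = ≤-reflexive (+-suc (length l) (length r))

  step-size : ∀ a b → step M a ≡ just b → size a ≤ size b
  step-size (conf q l c r) b e = apply-size (δ q c) q l c r b (trans (sym (step-apply q l c r)) e)

  run-size : ∀ t a b → run M t a ≡ just b → size a ≤ size b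
  run-size zero    a b refl = ≤-refl
  run-size (suc t) a b e with step M a in eq | trans (sym (run-suc t a)) e
  ... | just a′ | e′ = ≤-trans (step-size a a′ eq) (run-size t a′ b e′)

  run-+ : ∀ t₁ t₂ a b → run M t₁ a ≡ just b → run M (t₁ + t₂) a ≡ run M t₂ b
  run-+ zero     t₂ a b refl = refl
  run-+ (suc t₁) t₂ a b e = after (step M a) refl (trans (sym (run-suc t₁ a)) e)
    where
    after : ∀ m → step M a ≡ m → (m >>= run M t₁) ≡ just b → run M (suc t₁ + t₂) a ≡ run M t₂ b
    after (just a′) eq e′ =
      trans (run-suc (t₁ + t₂) a) (trans (cong (_>>= run M (t₁ + t₂)) eq) (run-+ t₁ t₂ a′ b e′))

  record Reach (a b : Cfg) (k : ℕ) : Set where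
    constructor reach
    field
      time       : ℕ
      time-bound : time ≤ k * suc (size b)
      runs       : run M time a ≡ just b

  Reach-refl : ∀ a → Reach a a 0
  Reach-refl a = reach 0 z≤n refl

  Reach-step : ∀ {a b} → step M a ≡ just b → Reach a b 1
  Reach-step {a} e = reach 1 (s≤s z≤n) (trans (run-suc 0 a) (cong (_>>= run M 0) e))

  infixr 4 _▸_
  _▸_ : ∀ {a b c k m} → Reach a b k → Reach b c m → Reach a c (k + m)
  _▸_ {a} {b} {c} {k} {m} (reach t₁ le₁ e₁) (reach t₂ le₂ e₂) = reach (t₁ + t₂)
    (≤-trans (+-mono-≤ (≤-trans le₁ (*-monoʳ-≤ k (s≤s (run-size t₂ b c e₂)))) le₂)
             (≤-reflexive (sym (*-distribʳ-+ (suc (size c)) k m))))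
    (trans (run-+ t₁ t₂ a b e₁) e₂)

  Reach-weaken : ∀ {a b k m} → k ≤ m → Reach a b k → Reach a b m
  Reach-weaken {b = b} k≤m (reach t le e) = reach t (≤-trans le (*-monoˡ-≤ (suc (size b)) k≤m)) e

-- On input 1ⁿ 0 M (M the adjacency matrix, row by row) it
-- replaces the prefix 1ⁿ by n column markers, writes the output prefix
-- 1³ⁿ 0 after M, and then, for each row v of M, makes three passes
-- i = 0, 1, 2.  Pass i visits the markers in order; for marker w it reads
-- entry (v , w) of M and appends the three bits of row (v , i) of the
-- prism against (w , 0), (w , 1), (w , 2).  The output ends up right of
-- the consumed input, and the machine halts on its first bit.

-- Column markers.  While row v of the input matrix is processed, the
-- marker of column w has type D (w < v, done), C (w = v, current) or
-- N (w > v, next).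
data Ty : Set where
  D C N : Ty

isCurrent : Ty → Bool
isCurrent C = true
isCurrent _ = false

data Sy : Set where
  Bl  : Sy
  B   : Bool → Sy       -- a bit: unread matrix entry, or output
  P   : Ty → Bool → Sy  -- column marker; the flag records "handled in this pass"
  SEP : Sy              -- ends the block of markers
  Cn  : Bool → Sy       -- matrix entry of the current row, read in this pass
  Dn  : Bool → Sy       -- matrix entry of a finished row

data St : Set where
  -- initial phase: turn the unary prefix 1ⁿ into markers, write 1³ⁿ0
  S0 S1 S2 A1 A2 A3 A4 A5 A6 : St
  -- walk back to the left end, then start pass i / clear pass i
  WCol WClr : Fin 3 → St
  -- pass i over the current row: pick the next unhandled marker
  Col : Fin 3 → St
  -- found a marker (flag: it is the current column); look for its entry
  Find : Fin 3 → Bool → St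
  -- carrying the entry bit to the end; write the three output bits
  Go O1 O2 : Fin 3 → Bool → Bool → St
  -- end of pass i: restore (i < 2) or retire (i = 2) the read entries
  Rst : Fin 3 → St
  -- unflag the markers; after pass 2 also shift the current column
  Clr : Fin 3 → St
  ClrA ClrB : St
  -- all rows done: move to the start of the output and halt
  Final : St
  -- empty input graph: write the code of K₃ from right to left
  Emit : Fin 12 → St

-- the code of K₃ but its last bit, which is the input bit 0 itself
emitted : Fin 12 → Bool
emitted k = Vec.lookup (Vec.fromList (encode K₃)) (F.inject₁ k)

-- what becomes of an entry read in pass i: unread again, or retired
afterPass : Fin 3 → Bool → Sy
afterPass (suc (suc zero)) b = Dn b
afterPass _ b = B b

δ′ : St → Sy → Maybe (St × Sy × Move)
δ′ S0 (B true) = just (S1 , B true , L)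
δ′ S0 (B false) = just (Emit (F.fromℕ 11) , B false , L)
δ′ S1 Bl = just (S2 , Bl , R)
δ′ S2 (B true) = just (A2 , P C false , R)
δ′ A2 Bl = just (A3 , B true , R)
δ′ A2 x = just (A2 , x , R)
δ′ A3 Bl = just (A4 , B true , R)
δ′ A4 Bl = just (A6 , B true , L)
δ′ A6 (P t c) = just (A1 , P t c , R)
δ′ A6 Bl = nothing
δ′ A6 x = just (A6 , x , L)
δ′ A1 (B true) = just (A2 , P N false , R)
δ′ A1 (B false) = just (A5 , SEP , R)
δ′ A5 Bl = just (WCol zero , B false , L)
δ′ A5 x = just (A5 , x , R)
δ′ (WCol i) Bl = just (Col i , Bl , R)
δ′ (WCol i) x = just (WCol i , x , L)
δ′ (WClr i) Bl = just (Clr i , Bl , R)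
δ′ (WClr i) x = just (WClr i , x , L)
δ′ (Col i) (P t true) = just (Col i , P t true , R)
δ′ (Col i) (P t false) = just (Find i (isCurrent t) , P t true , R)
δ′ (Col i) SEP = just (Rst i , SEP , R)
δ′ (Find i d) (B b) = just (Go i d b , Cn b , R)
δ′ (Find i d) Bl = nothing
δ′ (Find i d) x = just (Find i d , x , R)
δ′ (Go i d b) Bl = just (O1 i d b , B (prismBit i d b zero) , R)
δ′ (Go i d b) x = just (Go i d b , x , R)
δ′ (O1 i d b) Bl = just (O2 i d b , B (prismBit i d b (suc zero)) , R)
δ′ (O2 i d b) Bl = just (WCol i , B (prismBit i d b (suc (suc zero))) , L)
δ′ (Rst i) (Dn b) = just (Rst i , Dn b , R)
δ′ (Rst i) (Cn b) = just (Rst i , afterPass i b , R)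
δ′ (Rst i) (B b) = just (WClr i , B b , L)
δ′ (Clr zero) (P t true) = just (Clr zero , P t false , R)
δ′ (Clr zero) SEP = just (WCol (suc zero) , SEP , L)
δ′ (Clr (suc zero)) (P t true) = just (Clr (suc zero) , P t false , R)
δ′ (Clr (suc zero)) SEP = just (WCol (suc (suc zero)) , SEP , L)
δ′ (Clr (suc (suc zero))) (P D true) = just (Clr (suc (suc zero)) , P D false , R)
δ′ (Clr (suc (suc zero))) (P C true) = just (ClrA , P D false , R)
δ′ ClrA (P N true) = just (ClrB , P C false , R)
δ′ ClrA SEP = just (Final , SEP , R)
δ′ ClrB (P N true) = just (ClrB , P N false , R)
δ′ ClrB SEP = just (WCol zero , SEP , L)
δ′ Final (Dn b) = just (Final , Dn b , R)
δ′ (Emit zero) Bl = just (Final , B (emitted zero) , S)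
δ′ (Emit (suc k)) Bl = just (Emit (F.inject₁ k) , B (emitted (suc k)) , L)
δ′ _ _ = nothing

-- Symbols and states are coded by sum and product codes; Bl, B false and
-- B true get the codes 0, 1, 2 demanded by the machine model.
finite-Ty : Finite Ty
finite-Ty = finite-retract (finite-Fin 3) code (Vec.lookup (D ∷ C ∷ N ∷ [])) λ { D → refl ; C → refl ; N → refl }
  where
  code : Ty → Fin 3
  code D = zero
  code C = suc zero
  code N = suc (suc zero)

finite-Sy : Finite Sy
finite-Sy = finite-retract
  (finite-⊎ (finite-Fin 1) (finite-⊎ finite-Bool (finite-⊎ (finite-× finite-Ty finite-Bool)
    (finite-⊎ (finite-Fin 1) (finite-⊎ finite-Bool finite-Bool)))))
  code decode decode-code
  where
  code : Sy → _
  code Bl      = inj₁ zero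
  code (B b)   = inj₂ (inj₁ b)
  code (P t b) = inj₂ (inj₂ (inj₁ (t , b)))
  code SEP     = inj₂ (inj₂ (inj₂ (inj₁ zero)))
  code (Cn b)  = inj₂ (inj₂ (inj₂ (inj₂ (inj₁ b))))
  code (Dn b)  = inj₂ (inj₂ (inj₂ (inj₂ (inj₂ b))))
  decode : _ → Sy
  decode (inj₁ _)                                = Bl
  decode (inj₂ (inj₁ b))                         = B b
  decode (inj₂ (inj₂ (inj₁ (t , b))))            = P t b
  decode (inj₂ (inj₂ (inj₂ (inj₁ _))))           = SEP
  decode (inj₂ (inj₂ (inj₂ (inj₂ (inj₁ b)))))    = Cn b
  decode (inj₂ (inj₂ (inj₂ (inj₂ (inj₂ b)))))    = Dn b
  decode-code : ∀ x → decode (code x) ≡ x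
  decode-code Bl      = refl
  decode-code (B b)   = refl
  decode-code (P t b) = refl
  decode-code SEP     = refl
  decode-code (Cn b)  = refl
  decode-code (Dn b)  = refl

finite-St : Finite St
finite-St = finite-retract
  (finite-⊎ (finite-Fin 12) (finite-⊎ (finite-× (finite-Fin 5) (finite-Fin 3)) (finite-⊎ (finite-× (finite-Fin 3) finite-Bool)
    (finite-⊎ (finite-× (finite-Fin 3) (finite-× (finite-Fin 3) (finite-× finite-Bool finite-Bool))) (finite-Fin 12)))))
  code decode decode-code
  where
  simple : Vec St 12
  simple = S0 ∷ S1 ∷ S2 ∷ A1 ∷ A2 ∷ A3 ∷ A4 ∷ A5 ∷ A6 ∷ ClrA ∷ ClrB ∷ Final ∷ []
  indexed : Vec (Fin 3 → St) 5
  indexed = WCol ∷ WClr ∷ Col ∷ Rst ∷ Clr ∷ []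
  carrying : Vec (Fin 3 → Bool → Bool → St) 3
  carrying = Go ∷ O1 ∷ O2 ∷ []
  code : St → _
  code S0         = inj₁ (F.# 0)
  code S1         = inj₁ (F.# 1)
  code S2         = inj₁ (F.# 2)
  code A1         = inj₁ (F.# 3)
  code A2         = inj₁ (F.# 4)
  code A3         = inj₁ (F.# 5)
  code A4         = inj₁ (F.# 6)
  code A5         = inj₁ (F.# 7)
  code A6         = inj₁ (F.# 8)
  code ClrA       = inj₁ (F.# 9)
  code ClrB       = inj₁ (F.# 10)
  code Final      = inj₁ (F.# 11)
  code (WCol i)   = inj₂ (inj₁ (F.# 0 , i))
  code (WClr i)   = inj₂ (inj₁ (F.# 1 , i))
  code (Col i)    = inj₂ (inj₁ (F.# 2 , i))
  code (Rst i)    = inj₂ (inj₁ (F.# 3 , i))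
  code (Clr i)    = inj₂ (inj₁ (F.# 4 , i))
  code (Find i d) = inj₂ (inj₂ (inj₁ (i , d)))
  code (Go i d b) = inj₂ (inj₂ (inj₂ (inj₁ (F.# 0 , i , d , b))))
  code (O1 i d b) = inj₂ (inj₂ (inj₂ (inj₁ (F.# 1 , i , d , b))))
  code (O2 i d b) = inj₂ (inj₂ (inj₂ (inj₁ (F.# 2 , i , d , b))))
  code (Emit k)   = inj₂ (inj₂ (inj₂ (inj₂ k)))
  decode : _ → St
  decode (inj₁ k)                                     = Vec.lookup simple k
  decode (inj₂ (inj₁ (f , i)))                        = Vec.lookup indexed f i
  decode (inj₂ (inj₂ (inj₁ (i , d))))                 = Find i d
  decode (inj₂ (inj₂ (inj₂ (inj₁ (f , i , d , b)))))  = Vec.lookup carrying f i d b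
  decode (inj₂ (inj₂ (inj₂ (inj₂ k))))                = Emit k
  decode-code : ∀ q → decode (code q) ≡ q
  decode-code S0         = refl
  decode-code S1         = refl
  decode-code S2         = refl
  decode-code A1         = refl
  decode-code A2         = refl
  decode-code A3         = refl
  decode-code A4         = refl
  decode-code A5         = refl
  decode-code A6         = refl
  decode-code ClrA       = refl
  decode-code ClrB       = refl
  decode-code Final      = refl
  decode-code (WCol i)   = refl
  decode-code (WClr i)   = refl
  decode-code (Col i)    = refl
  decode-code (Rst i)    = refl
  decode-code (Clr i)    = refl
  decode-code (Find i d) = refl
  decode-code (Go i d b) = refl
  decode-code (O1 i d b) = refl
  decode-code (O2 i d b) = refl
  decode-code (Emit k)   = refl

encS : Sy → Fin 14
encS = index finite-Sy

encQ : St → Fin (card finite-St)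
encQ = index finite-St

encTr : Maybe (St × Sy × Move) → Maybe (Fin (card finite-St) × Fin 14 × Move)
encTr = Maybe.map (Prod.map encQ (Prod.map₁ encS))

M : TM
M = record
  { Q = card finite-St ; s = 11 ; start = encQ S0
  ; δ = λ q x → encTr (δ′ (element finite-St q) (element finite-Sy x)) }

open Runs M

-- reading a tape segment, blank beyond its end
hd : List Sy → Sy
hd []      = Bl
hd (x ∷ _) = x

tl : List Sy → List Sy
tl []       = []
tl (_ ∷ xs) = xs

-- A configuration in symbolic form: the tape left of the head nearest
-- first, and the tape from the head on (the scanned cell is hd rs).
cfg : St → List Sy → List Sy → Cfg
cfg q ls rs = conf (encQ q) (map encS ls) (encS (hd rs)) (map encS (tl rs))

δ-code : ∀ q x → TM.δ M (encQ q) (encS x) ≡ encTr (δ′ q x)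
δ-code q x = cong₂ (λ q′ x′ → encTr (δ′ q′ x′)) (element-index finite-St q) (element-index finite-Sy x)

moved : St → Sy → Move → List Sy → List Sy → Cfg
moved q y R ls rs = cfg q (y ∷ ls) rs
moved q y L ls rs = cfg q (tl ls) (hd ls ∷ y ∷ rs)
moved q y S ls rs = cfg q ls (y ∷ rs)

moveHead-cfg : ∀ q y m ls rs → moveHead M (encQ q) m (map encS ls) (encS y) (map encS rs) ≡ moved q y m ls rs
moveHead-cfg q y R ls []      = refl
moveHead-cfg q y R ls (_ ∷ _) = refl
moveHead-cfg q y L []      rs = refl
moveHead-cfg q y L (_ ∷ _) rs = refl
moveHead-cfg q y S ls rs      = refl

step-cfg : ∀ q ls rs → step M (cfg q ls rs) ≡ Maybe.map (λ (q′ , y , m) → moved q′ y m ls (tl rs)) (δ′ q (hd rs))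
step-cfg q ls rs =
  trans (step-apply (encQ q) (map encS ls) (encS (hd rs)) (map encS (tl rs)))
    (trans (cong (λ e → apply e (map encS ls) (encS (hd rs)) (map encS (tl rs))) (δ-code q (hd rs)))
      (by-cases (δ′ q (hd rs))))
  where
  by-cases : ∀ e → apply (encTr e) (map encS ls) (encS (hd rs)) (map encS (tl rs))
                 ≡ Maybe.map (λ (q′ , y , m) → moved q′ y m ls (tl rs)) e
  by-cases nothing            = refl
  by-cases (just (q′ , y , m)) = cong just (moveHead-cfg q′ y m ls (tl rs))

step-moves : ∀ {q q′ y m} ls rs → δ′ q (hd rs) ≡ just (q′ , y , m) → Reach (cfg q ls rs) (moved q′ y m ls (tl rs)) 1
step-moves {q} ls rs e = Reach-step (trans (step-cfg q ls rs) (cong (Maybe.map _) e))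

step-halts : ∀ {q} ls rs → δ′ q (hd rs) ≡ nothing → step M (cfg q ls rs) ≡ nothing
step-halts {q} ls rs e = trans (step-cfg q ls rs) (cong (Maybe.map _) e)

size-cfg : ∀ q ls rs → size (cfg q ls rs) ≡ length ls + length (tl rs)
size-cfg q ls rs = cong₂ _+_ (length-map encS ls) (length-map encS (tl rs))

sweep-right : ∀ q (g : Sy → Sy) xs ls rs → All (λ x → δ′ q x ≡ just (q , g x , R)) xs →
  Reach (cfg q ls (xs ++ rs)) (cfg q (map g xs ʳ++ ls) rs) 1
sweep-right q g xs ls rs ps = reach (length xs) bound (runs′ xs ls ps)
  where
  runs′ : ∀ xs ls → All (λ x → δ′ q x ≡ just (q , g x , R)) xs →
    run M (length xs) (cfg q ls (xs ++ rs)) ≡ just (cfg q (map g xs ʳ++ ls) rs)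
  runs′ []       ls []       = refl
  runs′ (x ∷ xs) ls (p ∷ ps) = trans (run-suc (length xs) (cfg q ls (x ∷ xs ++ rs)))
    (trans (cong (_>>= run M (length xs)) (trans (step-cfg q ls (x ∷ xs ++ rs)) (cong (Maybe.map _) p)))
      (runs′ xs (g x ∷ ls) ps))
  bound : length xs ≤ 1 * suc (size (cfg q (map g xs ʳ++ ls) rs))
  bound rewrite *-identityˡ (suc (size (cfg q (map g xs ʳ++ ls) rs))) | size-cfg q (map g xs ʳ++ ls) rs
              | length-ʳ++ (map g xs) {ls} | length-map g xs =
    ≤-trans (m≤m+n (length xs) (length ls)) (≤-trans (m≤m+n _ (length (tl rs))) (n≤1+n _))

sweep-left : ∀ q x ys z ls rs → All (λ w → δ′ q w ≡ just (q , w , L)) (x ∷ ys) →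
  Reach (cfg q (ys ++ z ∷ ls) (x ∷ rs)) (cfg q ls (z ∷ (ys ʳ++ (x ∷ rs)))) 1
sweep-left q x ys z ls rs ps = reach (suc (length ys)) bound (runs′ x ys rs ps)
  where
  runs′ : ∀ x ys rs → All (λ w → δ′ q w ≡ just (q , w , L)) (x ∷ ys) →
    run M (suc (length ys)) (cfg q (ys ++ z ∷ ls) (x ∷ rs)) ≡ just (cfg q ls (z ∷ (ys ʳ++ (x ∷ rs))))
  runs′ x []       rs (p ∷ [])     = trans (run-suc 0 (cfg q (z ∷ ls) (x ∷ rs)))
    (cong (_>>= run M 0) (trans (step-cfg q (z ∷ ls) (x ∷ rs)) (cong (Maybe.map _) p)))
  runs′ x (y ∷ ys) rs (p ∷ ps) = trans (run-suc (suc (length ys)) (cfg q (y ∷ ys ++ z ∷ ls) (x ∷ rs)))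
    (trans (cong (_>>= run M (suc (length ys))) (trans (step-cfg q (y ∷ ys ++ z ∷ ls) (x ∷ rs)) (cong (Maybe.map _) p)))
      (runs′ y ys (x ∷ rs) ps))
  bound : suc (length ys) ≤ 1 * suc (size (cfg q ls (z ∷ (ys ʳ++ (x ∷ rs)))))
  bound rewrite *-identityˡ (suc (size (cfg q ls (z ∷ (ys ʳ++ (x ∷ rs)))))) | size-cfg q ls (z ∷ (ys ʳ++ (x ∷ rs)))
              | length-ʳ++ ys {x ∷ rs} =
    s≤s (≤-trans (m≤m+n (length ys) (suc (length rs))) (m≤n+m _ (length ls)))

All-ʳ++ : ∀ {P : Sy → Set} xs {ys} → All P xs → All P ys → All P (xs ʳ++ ys)
All-ʳ++ []       []       pys = pys
All-ʳ++ (x ∷ xs) (p ∷ ps) pys = All-ʳ++ xs ps (p ∷ pys)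

walk-left : ∀ {q q₂ q′ y z} Lr ls rs → δ′ q (hd rs) ≡ just (q₂ , y , L) → δ′ q₂ z ≡ just (q′ , z , R) →
  All (λ w → δ′ q₂ w ≡ just (q₂ , w , L)) Lr →
  Reach (cfg q (Lr ++ z ∷ ls) rs) (cfg q′ (z ∷ ls) (Lr ʳ++ (y ∷ tl rs))) 3
walk-left {y = y} {z} [] ls rs e₁ e₂ [] =
  Reach-weaken (n≤1+n 2) (step-moves (z ∷ ls) rs e₁ ▸ step-moves ls (z ∷ y ∷ tl rs) e₂)
walk-left {y = y} {z} (w ∷ Lr) ls rs e₁ e₂ ps =
  step-moves (w ∷ Lr ++ z ∷ ls) rs e₁ ▸
  sweep-left _ w Lr z ls (y ∷ tl rs) ps ▸
  step-moves ls (z ∷ (Lr ʳ++ (w ∷ y ∷ tl rs))) e₂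

-- Views: configurations with the tape left of the head in reading order.
-- All phases are stated on views; their reachability lemmas are below.
data View : Set where
  ⟨_∣_▸_⟩ : St → List Sy → List Sy → View

toCfg : View → Cfg
toCfg ⟨ q ∣ Lf ▸ rs ⟩ = cfg q (reverse Lf) rs

home : St → List Sy → View
home q T = ⟨ q ∣ [ Bl ] ▸ T ⟩

-- Reachability between views; a record, so that views are inferable.
record _⇝⟨_⟩_ (x : View) (k : ℕ) (y : View) : Set where
  constructor lift
  field lower : Reach (toCfg x) (toCfg y) k
open _⇝⟨_⟩_

infixr 4 _⟫_
_⟫_ : ∀ {x y z k m} → x ⇝⟨ k ⟩ y → y ⇝⟨ m ⟩ z → x ⇝⟨ k + m ⟩ z
lift r ⟫ lift r′ = lift (r ▸ r′)

⇝-refl : ∀ {x} → x ⇝⟨ 0 ⟩ x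
⇝-refl {x} = lift (Reach-refl (toCfg x))

⇝-weaken : ∀ {x y k m} → k ≤ m → x ⇝⟨ k ⟩ y → x ⇝⟨ m ⟩ y
⇝-weaken le (lift r) = lift (Reach-weaken le r)

cast-source : ∀ {x x′ y k} → x ≡ x′ → x ⇝⟨ k ⟩ y → x′ ⇝⟨ k ⟩ y
cast-source refl r = r

cast-target : ∀ {x y y′ k} → y ≡ y′ → x ⇝⟨ k ⟩ y → x ⇝⟨ k ⟩ y′
cast-target refl r = r

cast-bound : ∀ {x y k k′} → k ≡ k′ → x ⇝⟨ k ⟩ y → x ⇝⟨ k′ ⟩ y
cast-bound refl r = r

⇝-right : ∀ {q q′ y} Lf rs → δ′ q (hd rs) ≡ just (q′ , y , R) → ⟨ q ∣ Lf ▸ rs ⟩ ⇝⟨ 1 ⟩ ⟨ q′ ∣ Lf ++ [ y ] ▸ tl rs ⟩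
⇝-right {q′ = q′} {y} Lf rs e =
  lift (subst (λ ls → Reach _ (cfg q′ ls (tl rs)) 1) (sym (++-ʳ++ Lf {[ y ]})) (step-moves (reverse Lf) rs e))

⇝-sweep : ∀ q (g : Sy → Sy) xs Lf rs → All (λ x → δ′ q x ≡ just (q , g x , R)) xs →
  ⟨ q ∣ Lf ▸ xs ++ rs ⟩ ⇝⟨ 1 ⟩ ⟨ q ∣ Lf ++ map g xs ▸ rs ⟩
⇝-sweep q g xs Lf rs ps =
  lift (subst (λ ls → Reach _ (cfg q ls rs) 1) (sym (++-ʳ++ Lf {map g xs})) (sweep-right q g xs (reverse Lf) rs ps))

⇝-skip : ∀ q xs Lf rs → All (λ x → δ′ q x ≡ just (q , x , R)) xs →
  ⟨ q ∣ Lf ▸ xs ++ rs ⟩ ⇝⟨ 1 ⟩ ⟨ q ∣ Lf ++ xs ▸ rs ⟩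
⇝-skip q xs Lf rs ps = cast-target (cong (λ ys → ⟨ q ∣ Lf ++ ys ▸ rs ⟩) (map-id xs)) (⇝-sweep q (λ x → x) xs Lf rs ps)

⇝-skip-end : ∀ q xs Lf → All (λ x → δ′ q x ≡ just (q , x , R)) xs → ⟨ q ∣ Lf ▸ xs ⟩ ⇝⟨ 1 ⟩ ⟨ q ∣ Lf ++ xs ▸ [] ⟩
⇝-skip-end q xs Lf ps =
  cast-source (cong (λ ys → ⟨ q ∣ Lf ▸ ys ⟩) (++-identityʳ xs)) (⇝-skip q xs Lf [] ps)

⇝-walk : ∀ {q q₂ q′ y z} Lf₀ Lf rs → δ′ q (hd rs) ≡ just (q₂ , y , L) → δ′ q₂ z ≡ just (q′ , z , R) →
  All (λ w → δ′ q₂ w ≡ just (q₂ , w , L)) Lf →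
  ⟨ q ∣ Lf₀ ++ z ∷ Lf ▸ rs ⟩ ⇝⟨ 3 ⟩ ⟨ q′ ∣ Lf₀ ++ [ z ] ▸ Lf ++ y ∷ tl rs ⟩
⇝-walk {q} {q′ = q′} {y} {z} Lf₀ Lf rs e₁ e₂ ps =
  lift (subst₂ (λ ls ls′ → Reach (cfg q ls rs) ls′ 3) (sym left-source) target
    (walk-left (reverse Lf) (reverse Lf₀) rs e₁ e₂ (All-ʳ++ Lf ps [])))
  where
  left-source : reverse (Lf₀ ++ z ∷ Lf) ≡ reverse Lf ++ z ∷ reverse Lf₀
  left-source = trans (++-ʳ++ Lf₀ {z ∷ Lf}) (ʳ++-defn Lf)
  target : cfg q′ (z ∷ reverse Lf₀) (reverse Lf ʳ++ (y ∷ tl rs)) ≡ cfg q′ (reverse (Lf₀ ++ [ z ])) (Lf ++ y ∷ tl rs)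
  target = cong₂ (cfg q′) (sym (++-ʳ++ Lf₀ {[ z ]}))
    (trans (ʳ++-defn (reverse Lf)) (cong (_++ y ∷ tl rs) (reverse-involutive Lf)))

-- The walks home pass over blank-free tape and stop at the left blank.
NonBlank : Sy → Set
NonBlank x = x ≢ Bl

WalksLeft : St → Set
WalksLeft q = ∀ w → NonBlank w → δ′ q w ≡ just (q , w , L)

WCol-walks : ∀ i → WalksLeft (WCol i)
WCol-walks i Bl      nb = ⊥-elim (nb refl)
WCol-walks i (B _)   nb = refl
WCol-walks i (P _ _) nb = refl
WCol-walks i SEP     nb = refl
WCol-walks i (Cn _)  nb = refl
WCol-walks i (Dn _)  nb = refl

WClr-walks : ∀ i → WalksLeft (WClr i)
WClr-walks i Bl      nb = ⊥-elim (nb refl)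
WClr-walks i (B _)   nb = refl
WClr-walks i (P _ _) nb = refl
WClr-walks i SEP     nb = refl
WClr-walks i (Cn _)  nb = refl
WClr-walks i (Dn _)  nb = refl

⇝-home : ∀ {q q₂ q′ y} Lf rs T → δ′ q (hd rs) ≡ just (q₂ , y , L) → δ′ q₂ Bl ≡ just (q′ , Bl , R) → WalksLeft q₂ →
  Lf ++ y ∷ tl rs ≡ T → All NonBlank T → ⟨ q ∣ Bl ∷ Lf ▸ rs ⟩ ⇝⟨ 3 ⟩ home q′ T
⇝-home Lf rs T e₁ e₂ ok refl nb = ⇝-walk [] Lf rs e₁ e₂ (All.map (λ {w} → ok w) (++⁻ˡ Lf nb))

All-map : ∀ {A : Set} {P : Sy → Set} (f : A → Sy) → (∀ a → P (f a)) → ∀ xs → All P (map f xs)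
All-map f h xs = map⁺ (All.universal h xs)

-- Reassociating a left-nested concatenation to the right, to identify the
-- tapes produced by chains of sweeps.
cat : List (List Sy) → List Sy
cat []           = []
cat (x ∷ [])     = x
cat (x ∷ y ∷ xs) = x ++ cat (y ∷ xs)

foldl-cat : ∀ acc xs → Data.List.foldl _++_ acc xs ≡ acc ++ cat xs
foldl-cat acc []           = sym (++-identityʳ acc)
foldl-cat acc (x ∷ [])     = refl
foldl-cat acc (x ∷ y ∷ xs) = trans (foldl-cat (acc ++ x) (y ∷ xs)) (++-assoc acc x (cat (y ∷ xs)))

reassoc : ∀ xs → Data.List.foldl _++_ [] xs ≡ cat xs
reassoc = foldl-cat []

snoc-map : ∀ {A : Set} (f : A → Sy) xs x Z → map f (xs ++ [ x ]) ++ Z ≡ map f xs ++ f x ∷ Z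
snoc-map f xs x Z = trans (cong (_++ Z) (map-++ f xs [ x ])) (++-assoc (map f xs) [ f x ] Z)

Pt Pf : Ty → Sy
Pt t = P t true
Pf t = P t false

-- The tape during a pass: handled markers tA, unhandled markers tB, the
-- retired entries Dd, the entries cs read in this pass, then the bits Rb
-- (the unread entries followed by the output written so far).
passTape : List Ty → List Ty → List Bool → List Bool → List Bool → List Sy
passTape tA tB Dd cs Rb = map Pt tA ++ map Pf tB ++ SEP ∷ map Dn Dd ++ map Cn cs ++ map B Rb

passTape-nonblank : ∀ tA tB Dd cs Rb → All NonBlank (passTape tA tB Dd cs Rb)
passTape-nonblank tA tB Dd cs Rb =
  ++⁺ (All-map Pt (λ _ ()) tA) (++⁺ (All-map Pf (λ _ ()) tB) ((λ ()) ∷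
  ++⁺ (All-map Dn (λ _ ()) Dd) (++⁺ (All-map Cn (λ _ ()) cs) (All-map B (λ _ ()) Rb))))

prismBits : Fin 3 → Bool → Bool → List Bool
prismBits i d b = tabulate (prismBit i d b)

trip : ∀ i tA t tB Dd cs b rest →
  home (Col i) (passTape tA (t ∷ tB) Dd cs (b ∷ rest)) ⇝⟨ 13 ⟩
  home (Col i) (passTape (tA ++ [ t ]) tB Dd (cs ++ [ b ]) (rest ++ prismBits i (isCurrent t) b))
trip i tA t tB Dd cs b rest =
  ⇝-skip (Col i) (map Pt tA) [ Bl ] _ (All-map Pt (λ _ → refl) tA) ⟫
  ⇝-right (Bl ∷ map Pt tA) (Pf t ∷ _) refl ⟫
  ⇝-skip (Find i d) (map Pf tB) _ _ (All-map Pf (λ _ → refl) tB) ⟫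
  ⇝-right _ (SEP ∷ _) refl ⟫
  ⇝-skip (Find i d) (map Dn Dd) _ _ (All-map Dn (λ _ → refl) Dd) ⟫
  ⇝-skip (Find i d) (map Cn cs) _ _ (All-map Cn (λ _ → refl) cs) ⟫
  ⇝-right _ (B b ∷ _) refl ⟫
  ⇝-skip-end (Go i d b) (map B rest) _ (All-map B (λ _ → refl) rest) ⟫
  ⇝-right _ [] refl ⟫
  ⇝-right _ [] refl ⟫
  ⇝-home _ [] _ refl refl (WCol-walks i) tape (passTape-nonblank (tA ++ [ t ]) tB Dd (cs ++ [ b ]) (rest ++ prismBits i d b))
  where
  d = isCurrent t
  tape = trans (reassoc (map Pt tA ∷ [ Pt t ] ∷ map Pf tB ∷ [ SEP ] ∷ map Dn Dd ∷ map Cn cs ∷ [ Cn b ] ∷ map B rest ∷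
                         [ B (prismBit i d b zero) ] ∷ [ B (prismBit i d b (suc zero)) ] ∷ [ B (prismBit i d b (suc (suc zero))) ] ∷ []))
    (sym (trans (snoc-map Pt tA t _)
      (cong (λ z → map Pt tA ++ Pt t ∷ map Pf tB ++ SEP ∷ map Dn Dd ++ z)
        (trans (snoc-map Cn cs b _) (cong (λ z → map Cn cs ++ Cn b ∷ z) (map-++ B rest (prismBits i d b)))))))

-- The output bits produced by pass i over a row with markers ts and
-- entries bs: the row of vertex (v , i) of the prism.
layerOutput : Fin 3 → List Ty → List Bool → List Bool
layerOutput i (t ∷ ts) (b ∷ bs) = prismBits i (isCurrent t) b ++ layerOutput i ts bs
layerOutput i _        _        = []

pass-loop : ∀ i tA tB Dd cs fr W → length tB ≡ length fr →
  home (Col i) (passTape tA tB Dd cs (fr ++ W)) ⇝⟨ 13 * length fr ⟩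
  home (Col i) (passTape (tA ++ tB) [] Dd (cs ++ fr) (W ++ layerOutput i tB fr))
pass-loop i tA [] Dd cs [] W e =
  cast-target (cong (home (Col i)) (sym (cong₂ (λ a c → passTape a [] Dd c (W ++ [])) (++-identityʳ tA) (++-identityʳ cs))))
    (cast-target (cong (λ w → home (Col i) (passTape tA [] Dd cs w)) (sym (++-identityʳ W))) ⇝-refl)
pass-loop i tA (t ∷ tB) Dd cs (b ∷ fs) W e =
  cast-bound (sym (*-suc 13 (length fs)))
   (trip i tA t tB Dd cs b (fs ++ W) ⟫
    cast-source (cong (λ w → home (Col i) (passTape (tA ++ [ t ]) tB Dd (cs ++ [ b ]) w)) (sym (++-assoc fs W (prismBits i (isCurrent t) b))))
      (cast-target (cong (home (Col i)) tape) (pass-loop i (tA ++ [ t ]) tB Dd (cs ++ [ b ]) fs (W ++ prismBits i (isCurrent t) b) (suc-injective e))))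
  where
  tape : passTape ((tA ++ [ t ]) ++ tB) [] Dd ((cs ++ [ b ]) ++ fs) ((W ++ prismBits i (isCurrent t) b) ++ layerOutput i tB fs)
       ≡ passTape (tA ++ t ∷ tB) [] Dd (cs ++ b ∷ fs) (W ++ layerOutput i (t ∷ tB) (b ∷ fs))
  tape rewrite ++-assoc tA [ t ] tB | ++-assoc cs [ b ] fs | ++-assoc W (prismBits i (isCurrent t) b) (layerOutput i tB fs) = refl

restore : Fin 3 → Sy → Sy
restore i (Cn b) = afterPass i b
restore i x      = x

unflagged : Sy → Sy
unflagged (P t c) = P t false
unflagged x       = x

map-restore : ∀ i r → map (restore i) (map Cn r) ≡ map (afterPass i) r
map-restore i []      = refl
map-restore i (b ∷ r) = cong (afterPass i b ∷_) (map-restore i r)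

map-unflagged : ∀ tys → map unflagged (map Pt tys) ≡ map Pf tys
map-unflagged []        = refl
map-unflagged (t ∷ tys) = cong (P t false ∷_) (map-unflagged tys)

afterPass-nonblank : ∀ i b → NonBlank (afterPass i b)
afterPass-nonblank zero             b ()
afterPass-nonblank (suc zero)       b ()
afterPass-nonblank (suc (suc zero)) b ()

reset : ∀ i tys Dd r w W →
  home (Col i) (passTape tys [] Dd r (w ∷ W)) ⇝⟨ 7 ⟩
  home (Clr i) (map Pt tys ++ SEP ∷ map Dn Dd ++ map (afterPass i) r ++ map B (w ∷ W))
reset i tys Dd r w W =
  ⇝-skip (Col i) (map Pt tys) [ Bl ] _ (All-map Pt (λ _ → refl) tys) ⟫
  ⇝-right (Bl ∷ map Pt tys) (SEP ∷ _) refl ⟫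
  ⇝-skip (Rst i) (map Dn Dd) _ _ (All-map Dn (λ _ → refl) Dd) ⟫
  ⇝-sweep (Rst i) (restore i) (map Cn r) _ _ (map⁺ (All.universal (λ _ → refl) r)) ⟫
  ⇝-home _ (B w ∷ map B W) _ refl refl (WClr-walks i) tape
    (++⁺ (All-map Pt (λ _ ()) tys) ((λ ()) ∷ ++⁺ (All-map Dn (λ _ ()) Dd) (++⁺ (All-map (afterPass i) (afterPass-nonblank i) r) (All-map B (λ _ ()) (w ∷ W)))))
  where
  tape = trans (reassoc (map Pt tys ∷ [ SEP ] ∷ map Dn Dd ∷ map (restore i) (map Cn r) ∷ map B (w ∷ W) ∷ []))
               (cong (λ z → map Pt tys ++ SEP ∷ map Dn Dd ++ z ++ map B (w ∷ W)) (map-restore i r))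

unflag : ∀ {i j} → (∀ t → δ′ (Clr i) (P t true) ≡ just (Clr i , P t false , R)) → δ′ (Clr i) SEP ≡ just (WCol j , SEP , L) →
  ∀ tys X → All NonBlank X → home (Clr i) (map Pt tys ++ SEP ∷ X) ⇝⟨ 4 ⟩ home (Col j) (map Pf tys ++ SEP ∷ X)
unflag {i} {j} h e tys X nbX =
  ⇝-sweep (Clr i) unflagged (map Pt tys) [ Bl ] _ (map⁺ (All.universal h tys)) ⟫
  ⇝-home _ (SEP ∷ X) _ e refl (WCol-walks j) (cong (_++ SEP ∷ X) (map-unflagged tys)) (++⁺ (All-map Pf (λ _ ()) tys) ((λ ()) ∷ nbX))

pass-restoring : ∀ {i j} → (∀ t → δ′ (Clr i) (P t true) ≡ just (Clr i , P t false , R)) → δ′ (Clr i) SEP ≡ just (WCol j , SEP , L) →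
  (∀ b → afterPass i b ≡ B b) →
  ∀ tys Dd r w W → length tys ≡ length r →
  home (Col i) (passTape [] tys Dd [] (r ++ w ∷ W)) ⇝⟨ 13 * length r + 11 ⟩
  home (Col j) (passTape [] tys Dd [] (r ++ w ∷ (W ++ layerOutput i tys r)))
pass-restoring {i} h e restores tys Dd r w W le =
  pass-loop i [] tys Dd [] r (w ∷ W) le ⟫
  reset i tys Dd r w (W ++ layerOutput i tys r) ⟫
  cast-target (cong (home (Col _)) tape)
    (unflag h e tys _ (++⁺ (All-map Dn (λ _ ()) Dd) (++⁺ (subst (All NonBlank) (sym restored) (All-map B (λ _ ()) r)) (All-map B (λ _ ()) (w ∷ (W ++ layerOutput i tys r))))))
  where
  restored : map (afterPass i) r ≡ map B r
  restored = map-cong restores r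
  tape : map Pf tys ++ SEP ∷ map Dn Dd ++ map (afterPass i) r ++ map B (w ∷ (W ++ layerOutput i tys r))
       ≡ passTape [] tys Dd [] (r ++ w ∷ (W ++ layerOutput i tys r))
  tape = cong (λ z → map Pf tys ++ SEP ∷ map Dn Dd ++ z)
    (trans (cong (_++ map B (w ∷ (W ++ layerOutput i tys r))) restored) (sym (map-++ B r (w ∷ (W ++ layerOutput i tys r)))))

two : Fin 3
two = suc (suc zero)

-- The markers while row v of an (v + 1 + k)-vertex graph is processed.
rowMarkers : ℕ → ℕ → List Ty
rowMarkers v k = replicate v D ++ C ∷ replicate k N

rowOutput : List Ty → List Bool → List Bool
rowOutput tys r = layerOutput zero tys r ++ layerOutput (suc zero) tys r ++ layerOutput two tys r

three-passes : ∀ tys Dd r w W → length tys ≡ length r →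
  home (Col zero) (passTape [] tys Dd [] (r ++ w ∷ W)) ⇝⟨ (13 * length r + 11) + ((13 * length r + 11) + (13 * length r + 7)) ⟩
  home (Clr two) (map Pt tys ++ SEP ∷ map Dn (Dd ++ r) ++ map B (w ∷ (W ++ rowOutput tys r)))
three-passes tys Dd r w W le =
  pass-restoring {zero} (λ _ → refl) refl (λ _ → refl) tys Dd r w W le ⟫
  pass-restoring {suc zero} (λ _ → refl) refl (λ _ → refl) tys Dd r w (W ++ out₀) le ⟫
  pass-loop two [] tys Dd [] r (w ∷ W₁) le ⟫
  cast-target (cong (home (Clr two)) tape) (reset two tys Dd r w (W₁ ++ out₂))
  where
  out₀ = layerOutput zero tys r
  out₂ = layerOutput two tys r
  W₁ = (W ++ out₀) ++ layerOutput (suc zero) tys r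
  retired : map (afterPass two) r ≡ map Dn r
  retired = map-cong (λ _ → refl) r
  tape : map Pt tys ++ SEP ∷ map Dn Dd ++ map (afterPass two) r ++ map B (w ∷ (W₁ ++ out₂))
       ≡ map Pt tys ++ SEP ∷ map Dn (Dd ++ r) ++ map B (w ∷ (W ++ rowOutput tys r))
  tape = cong (λ z → map Pt tys ++ SEP ∷ z)
    (trans (cong (λ z → map Dn Dd ++ z ++ map B (w ∷ (W₁ ++ out₂))) retired)
      (trans (sym (++-assoc (map Dn Dd) (map Dn r) _))
        (cong₂ (λ a b → a ++ map B (w ∷ b)) (sym (map-++ Dn Dd r))
          (trans (++-assoc (W ++ out₀) _ out₂) (++-assoc W out₀ _)))))

map-split : ∀ {A : Set} (f : A → Sy) xs ys Z → map f (xs ++ ys) ++ Z ≡ map f xs ++ map f ys ++ Z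
map-split f xs ys Z = trans (cong (_++ Z) (map-++ f xs ys)) (++-assoc (map f xs) (map f ys) Z)

unflag-D : ∀ v → All (λ x → δ′ (Clr two) x ≡ just (Clr two , unflagged x , R)) (map Pt (replicate v D))
unflag-D v = map⁺ (replicate⁺ v refl)

unflag-N : ∀ k → All (λ x → δ′ ClrB x ≡ just (ClrB , unflagged x , R)) (map Pt (replicate k N))
unflag-N k = map⁺ (replicate⁺ k refl)

replicate-snoc : ∀ {A : Set} v (x : A) Z → replicate (suc v) x ++ Z ≡ replicate v x ++ x ∷ Z
replicate-snoc zero    x Z = refl
replicate-snoc (suc v) x Z = cong (x ∷_) (replicate-snoc v x Z)

shift-current : ∀ v k X → All NonBlank X →
  home (Clr two) (map Pt (rowMarkers v (suc k)) ++ SEP ∷ X) ⇝⟨ 7 ⟩ home (Col zero) (map Pf (rowMarkers (suc v) k) ++ SEP ∷ X)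
shift-current v k X nbX =
  cast-source (cong (home (Clr two)) (sym (map-split Pt (replicate v D) (C ∷ N ∷ replicate k N) (SEP ∷ X))))
   (⇝-sweep (Clr two) unflagged (map Pt (replicate v D)) [ Bl ] _ (unflag-D v) ⟫
    ⇝-right _ (Pt C ∷ _) refl ⟫
    ⇝-right _ (Pt N ∷ _) refl ⟫
    ⇝-sweep ClrB unflagged (map Pt (replicate k N)) _ _ (unflag-N k) ⟫
    ⇝-home _ (SEP ∷ X) _ refl refl (WCol-walks zero) tape (++⁺ (All-map Pf (λ _ ()) (rowMarkers (suc v) k)) ((λ ()) ∷ nbX)))
  where
  tape = trans (reassoc (map unflagged (map Pt (replicate v D)) ∷ [ P D false ] ∷ [ P C false ] ∷ map unflagged (map Pt (replicate k N)) ∷ (SEP ∷ X) ∷ []))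
    (trans (cong₂ (λ a b → a ++ P D false ∷ P C false ∷ b ++ SEP ∷ X) (map-unflagged (replicate v D)) (map-unflagged (replicate k N)))
      (trans (sym (map-split Pf (replicate v D) (D ∷ C ∷ replicate k N) (SEP ∷ X)))
        (cong (λ z → map Pf z ++ SEP ∷ X) (sym (replicate-snoc v D (C ∷ replicate k N))))))

finishedLeft : ℕ → List Bool → List Sy
finishedLeft v Y = map Pf (replicate (suc v) D) ++ SEP ∷ map Dn Y

finish : ∀ v Y W →
  home (Clr two) (map Pt (rowMarkers v zero) ++ SEP ∷ map Dn Y ++ map B W) ⇝⟨ 4 ⟩ ⟨ Final ∣ Bl ∷ finishedLeft v Y ▸ map B W ⟩
finish v Y W =
  cast-source (cong (home (Clr two)) (sym (map-split Pt (replicate v D) (C ∷ []) (SEP ∷ map Dn Y ++ map B W))))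
   (cast-target (cong (λ z → ⟨ Final ∣ Bl ∷ z ▸ map B W ⟩) left)
    (⇝-sweep (Clr two) unflagged (map Pt (replicate v D)) [ Bl ] _ (unflag-D v) ⟫
     ⇝-right _ (Pt C ∷ _) refl ⟫
     ⇝-right _ (SEP ∷ _) refl ⟫
     ⇝-skip Final (map Dn Y) _ _ (All-map Dn (λ _ → refl) Y)))
  where
  left : ((map unflagged (map Pt (replicate v D)) ++ [ P D false ]) ++ [ SEP ]) ++ map Dn Y ≡ finishedLeft v Y
  left = trans (reassoc (map unflagged (map Pt (replicate v D)) ∷ [ P D false ] ∷ [ SEP ] ∷ map Dn Y ∷ []))
    (trans (cong (λ a → a ++ P D false ∷ SEP ∷ map Dn Y) (map-unflagged (replicate v D)))
      (trans (sym (map-split Pf (replicate v D) [ D ] (SEP ∷ map Dn Y)))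
        (cong (λ z → map Pf z ++ SEP ∷ map Dn Y) (trans (sym (replicate-snoc v D [])) (++-identityʳ _)))))

map-nonblank : ∀ Y W → All NonBlank (map Dn Y ++ map B W)
map-nonblank Y W = ++⁺ (All-map Dn (λ _ ()) Y) (All-map B (λ _ ()) W)

rowTime : ℕ → ℕ
rowTime n = 39 * n + 36

row-cost : ∀ n c → c ≤ 7 → ((13 * n + 11) + ((13 * n + 11) + (13 * n + 7))) + c ≤ rowTime n
row-cost n c c≤7 = ≤-trans (≤-reflexive (three n c)) (+-monoʳ-≤ (39 * n) (+-monoʳ-≤ 29 c≤7))
  where
  three : ∀ n c → ((13 * n + 11) + ((13 * n + 11) + (13 * n + 7))) + c ≡ 39 * n + (29 + c)
  three = solve-∀

next-row : ∀ v k Dd r W₀ → length (rowMarkers v (suc k)) ≡ length r → W₀ ≢ [] →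
  home (Col zero) (passTape [] (rowMarkers v (suc k)) Dd [] (r ++ W₀)) ⇝⟨ rowTime (length r) ⟩
  home (Col zero) (passTape [] (rowMarkers (suc v) k) (Dd ++ r) [] (W₀ ++ rowOutput (rowMarkers v (suc k)) r))
next-row v k Dd r []      le ne = ⊥-elim (ne refl)
next-row v k Dd r (w ∷ W) le ne =
  ⇝-weaken (row-cost (length r) 7 ≤-refl)
   (three-passes (rowMarkers v (suc k)) Dd r w W le ⟫
    shift-current v k _ (map-nonblank (Dd ++ r) (w ∷ (W ++ rowOutput (rowMarkers v (suc k)) r))))

last-row : ∀ v Dd r W₀ → length (rowMarkers v zero) ≡ length r → W₀ ≢ [] →
  home (Col zero) (passTape [] (rowMarkers v zero) Dd [] (r ++ W₀)) ⇝⟨ rowTime (length r) ⟩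
  ⟨ Final ∣ Bl ∷ finishedLeft v (Dd ++ r) ▸ map B (W₀ ++ rowOutput (rowMarkers v zero) r) ⟩
last-row v Dd r []      le ne = ⊥-elim (ne refl)
last-row v Dd r (w ∷ W) le ne =
  ⇝-weaken (row-cost (length r) 4 (m≤m+n 4 3))
   (three-passes (rowMarkers v zero) Dd r w W le ⟫ finish v (Dd ++ r) (w ∷ (W ++ rowOutput (rowMarkers v zero) r)))

matrixOutput : ℕ → List (List Bool) → List Bool
matrixOutput v []       = []
matrixOutput v (r ∷ Rs) = rowOutput (rowMarkers v (length Rs)) r ++ matrixOutput (suc v) Rs

length-rowMarkers : ∀ v k → length (rowMarkers v k) ≡ v + suc k
length-rowMarkers v k = trans (length-++ (replicate v D)) (cong₂ _+_ (length-replicate v) (cong suc (length-replicate k)))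

cong₃ : ∀ {A B C D : Set} (f : A → B → C → D) {a a′ b b′ c c′} → a ≡ a′ → b ≡ b′ → c ≡ c′ → f a b c ≡ f a′ b′ c′
cong₃ f refl refl refl = refl

nonempty-suffix : ∀ {A : Set} (xs : List A) {ys} → ys ≢ [] → xs ++ ys ≢ []
nonempty-suffix []      ne e = ne e
nonempty-suffix (x ∷ _) ne ()

nonempty-prefix : ∀ {A : Set} (xs : List A) {ys} → xs ≢ [] → xs ++ ys ≢ []
nonempty-prefix []      ne e = ne refl
nonempty-prefix (x ∷ _) ne ()

all-rows : ∀ n v Dd r Rs out → All (λ x → length x ≡ n) (r ∷ Rs) → n ≡ v + suc (length Rs) → out ≢ [] →
  home (Col zero) (passTape [] (rowMarkers v (length Rs)) Dd [] (r ++ concat Rs ++ out)) ⇝⟨ suc (length Rs) * rowTime n ⟩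
  ⟨ Final ∣ Bl ∷ finishedLeft (v + length Rs) (Dd ++ concat (r ∷ Rs)) ▸ map B (out ++ matrixOutput v (r ∷ Rs)) ⟩
all-rows n v Dd r [] out (lr ∷ []) en ne =
  cast-bound (trans (cong rowTime lr) (sym (+-identityʳ (rowTime n))))
    (cast-target (cong₂ (λ a b → ⟨ Final ∣ Bl ∷ finishedLeft a (Dd ++ b) ▸ map B (out ++ rowOutput (rowMarkers v zero) r ++ []) ⟩)
                         (sym (+-identityʳ v)) (sym (++-identityʳ r)))
      (cast-target (cong (λ z → ⟨ Final ∣ Bl ∷ finishedLeft v (Dd ++ r) ▸ map B (out ++ z) ⟩) (sym (++-identityʳ _)))
        (last-row v Dd r out (trans (length-rowMarkers v zero) (trans (sym en) (sym lr))) ne)))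
all-rows n v Dd r (r′ ∷ Rs′) out (lr ∷ lrs) en ne =
  cast-bound (cong (λ z → z + suc (length Rs′) * rowTime n) (cong rowTime lr))
   (next-row v (length Rs′) Dd r (concat (r′ ∷ Rs′) ++ out) (trans (length-rowMarkers v _) (trans (sym en) (sym lr)))
      (nonempty-suffix (concat (r′ ∷ Rs′)) ne) ⟫
    cast-source (cong (λ z → home (Col zero) (passTape [] (rowMarkers (suc v) (length Rs′)) (Dd ++ r) [] z)) unread)
     (cast-target final
       (all-rows n (suc v) (Dd ++ r) r′ Rs′ (out ++ out₀) lrs (trans en (+-suc v (suc (length Rs′)))) (nonempty-prefix out ne))))
  where
  out₀ = rowOutput (rowMarkers v (suc (length Rs′))) r
  unread : r′ ++ concat Rs′ ++ out ++ out₀ ≡ (concat (r′ ∷ Rs′) ++ out) ++ out₀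
  unread = trans (cong (r′ ++_) (sym (++-assoc (concat Rs′) out out₀)))
    (trans (sym (++-assoc r′ (concat Rs′ ++ out) out₀)) (cong (_++ out₀) (sym (++-assoc r′ (concat Rs′) out))))
  final : ⟨ Final ∣ Bl ∷ finishedLeft (suc v + length Rs′) ((Dd ++ r) ++ concat (r′ ∷ Rs′)) ▸ map B ((out ++ out₀) ++ matrixOutput (suc v) (r′ ∷ Rs′)) ⟩
        ≡ ⟨ Final ∣ Bl ∷ finishedLeft (v + suc (length Rs′)) (Dd ++ concat (r ∷ r′ ∷ Rs′)) ▸ map B (out ++ matrixOutput v (r ∷ r′ ∷ Rs′)) ⟩
  final = cong₃ (λ a b c → ⟨ Final ∣ Bl ∷ finishedLeft a b ▸ map B c ⟩)
                (sym (+-suc v (length Rs′))) (++-assoc Dd r _) (++-assoc out out₀ _)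

triples : ℕ → List Bool
triples zero    = []
triples (suc j) = true ∷ true ∷ true ∷ triples j

append-triple : ∀ Mk t c Rest →
  ⟨ A2 ∣ Bl ∷ Mk ++ [ P t c ] ▸ map B Rest ⟩ ⇝⟨ 6 ⟩ ⟨ A1 ∣ Bl ∷ Mk ++ [ P t c ] ▸ map B (Rest ++ triples 1) ⟩
append-triple Mk t c Rest =
  ⇝-skip-end A2 (map B Rest) (Bl ∷ Mk ++ [ P t c ]) (All-map B (λ _ → refl) Rest) ⟫
  ⇝-right _ [] refl ⟫
  ⇝-right _ [] refl ⟫
  cast-target (cong (λ z → ⟨ A1 ∣ Bl ∷ Mk ++ [ P t c ] ▸ z ⟩) ones)
   (cast-source (cong (λ w → ⟨ A4 ∣ w ▸ [] ⟩) left)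
    (⇝-walk {A4} {A6} {A1} {B true} {P t c} (Bl ∷ Mk) (map B (Rest ++ true ∷ true ∷ [])) [] refl refl (All-map B (λ _ → refl) _)))
  where
  left : Bl ∷ Mk ++ P t c ∷ map B (Rest ++ true ∷ true ∷ []) ≡ Bl ∷ (((Mk ++ [ P t c ]) ++ map B Rest) ++ [ B true ]) ++ [ B true ]
  left = cong (Bl ∷_) (sym (trans (reassoc (Mk ∷ [ P t c ] ∷ map B Rest ∷ [ B true ] ∷ [ B true ] ∷ []))
                                  (cong (λ z → Mk ++ P t c ∷ z) (sym (map-++ B Rest (true ∷ true ∷ []))))))
  ones : map B (Rest ++ true ∷ true ∷ []) ++ B true ∷ [] ≡ map B (Rest ++ triples 1)
  ones = trans (sym (map-++ B (Rest ++ true ∷ true ∷ []) [ true ])) (cong (map B) (++-assoc Rest (true ∷ true ∷ []) [ true ]))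

initial-phase : ∀ j Mk t c Mx out → All NonBlank Mk →
  ⟨ A2 ∣ Bl ∷ Mk ++ [ P t c ] ▸ map B (replicate j true ++ false ∷ Mx ++ out) ⟩ ⇝⟨ j * 7 + 11 ⟩
  home (Col zero) (Mk ++ P t c ∷ replicate j (P N false) ++ SEP ∷ map B (Mx ++ out ++ triples (suc j) ++ [ false ]))
initial-phase (suc j) Mk t c Mx out nb =
  append-triple Mk t c (replicate (suc j) true ++ false ∷ Mx ++ out) ⟫
  ⇝-right (Bl ∷ Mk ++ [ P t c ]) (B true ∷ _) refl ⟫
  cast-source (cong (λ z → ⟨ A2 ∣ Bl ∷ (Mk ++ [ P t c ]) ++ [ P N false ] ▸ map B z ⟩) shift)
    (cast-target (cong (home (Col zero)) (trans (cong (λ z → (Mk ++ [ P t c ]) ++ P N false ∷ replicate j (P N false) ++ SEP ∷ map B (Mx ++ z))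
                                                      (++-assoc out (triples 1) (triples (suc j) ++ [ false ])))
                                                (++-assoc Mk [ P t c ] _)))
      (initial-phase j (Mk ++ [ P t c ]) N false Mx (out ++ triples 1) (++⁺ nb ((λ ()) ∷ []))))
  where
  shift : replicate j true ++ false ∷ Mx ++ out ++ triples 1 ≡ (replicate j true ++ false ∷ Mx ++ out) ++ triples 1
  shift = trans (cong (λ z → replicate j true ++ false ∷ z) (sym (++-assoc Mx out (triples 1))))
                (sym (++-assoc (replicate j true) _ (triples 1)))
initial-phase zero Mk t c Mx out nb =
  append-triple Mk t c (false ∷ Mx ++ out) ⟫
  ⇝-right (Bl ∷ Mk ++ [ P t c ]) (B false ∷ _) refl ⟫
  ⇝-skip-end A5 (map B ((Mx ++ out) ++ triples 1)) _ (All-map B (λ _ → refl) ((Mx ++ out) ++ triples 1)) ⟫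
  ⇝-home _ [] _ refl refl (WCol-walks zero) tape
    (++⁺ nb ((λ ()) ∷ (λ ()) ∷ All-map B (λ _ ()) (Mx ++ out ++ triples 1 ++ [ false ])))
  where
  tape = trans (reassoc (Mk ∷ [ P t c ] ∷ [ SEP ] ∷ map B ((Mx ++ out) ++ triples 1) ∷ [ B false ] ∷ []))
    (cong (λ z → Mk ++ P t c ∷ SEP ∷ z)
      (trans (sym (map-++ B ((Mx ++ out) ++ triples 1) [ false ]))
        (cong (map B) (trans (++-assoc (Mx ++ out) (triples 1) [ false ]) (++-assoc Mx out _)))))

tabulate-split : ∀ {A : Set} k l (f : Fin (k + l) → A) →
  tabulate f ≡ tabulate (λ i → f (i F.↑ˡ l)) ++ tabulate (λ i → f (k F.↑ʳ i))
tabulate-split zero    l f = refl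
tabulate-split (suc k) l f = cong (f zero ∷_) (tabulate-split k l (λ i → f (suc i)))

tabulate-combine : ∀ {A : Set} m k (f : Fin (m * k) → A) →
  tabulate f ≡ concat (tabulate {n = m} λ a → tabulate {n = k} λ b → f (F.combine a b))
tabulate-combine zero    k f = refl
tabulate-combine (suc m) k f =
  trans (tabulate-split k (m * k) f) (cong (tabulate (λ i → f (i F.↑ˡ (m * k))) ++_) (tabulate-combine m k (λ i → f (k F.↑ʳ i))))

tabulate-const : ∀ {A : Set} m (x : A) → tabulate {n = m} (λ _ → x) ≡ replicate m x
tabulate-const zero    x = refl
tabulate-const (suc m) x = cong (x ∷_) (tabulate-const m x)

markerOf : ∀ {m} → Fin m → Fin m → Ty
markerOf zero    zero    = C
markerOf zero    (suc w) = N
markerOf (suc v) zero    = D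
markerOf (suc v) (suc w) = markerOf v w

tabulate-markerOf : ∀ {m} (v : Fin m) → tabulate (markerOf v) ≡ rowMarkers (toℕ v) (m ∸ suc (toℕ v))
tabulate-markerOf {suc m} zero    = cong (C ∷_) (tabulate-const m N)
tabulate-markerOf {suc m} (suc v) = cong (D ∷_) (tabulate-markerOf v)

isCurrent-markerOf : ∀ {m} (v w : Fin m) → isCurrent (markerOf v w) ≡ (v == w)
isCurrent-markerOf zero    zero    = refl
isCurrent-markerOf zero    (suc w) = refl
isCurrent-markerOf (suc v) zero    = refl
isCurrent-markerOf (suc v) (suc w) = isCurrent-markerOf v w

layerOutput-tabulate : ∀ {m} i (tf : Fin m → Ty) (bf : Fin m → Bool) →
  layerOutput i (tabulate tf) (tabulate bf) ≡ concat (tabulate λ w → prismBits i (isCurrent (tf w)) (bf w))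
layerOutput-tabulate {zero}  i tf bf = refl
layerOutput-tabulate {suc m} i tf bf = cong (prismBits i (isCurrent (tf zero)) (bf zero) ++_) (layerOutput-tabulate i (λ w → tf (suc w)) (λ w → bf (suc w)))

matrixOutput-tabulate : ∀ {m} a (f : Fin m → List Bool) →
  matrixOutput a (tabulate f) ≡ concat (tabulate λ k → rowOutput (rowMarkers (a + toℕ k) (m ∸ suc (toℕ k))) (f k))
matrixOutput-tabulate {zero}  a f = refl
matrixOutput-tabulate {suc m} a f =
  cong₂ _++_ (cong₂ (λ x y → rowOutput (rowMarkers x y) (f zero)) (sym (+-identityʳ a)) (length-tabulate (λ k → f (suc k))))
    (trans (matrixOutput-tabulate (suc a) (λ k → f (suc k)))
      (cong concat (tabulate-cong (λ k → cong (λ x → rowOutput (rowMarkers x (m ∸ suc (toℕ k))) (f (suc k))) (sym (+-suc a (toℕ k)))))))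

rowsOf : (G : Graph) → List (List Bool)
rowsOf G = tabulate λ v → tabulate λ w → adj G v w

matrixOutput-prism : ∀ G → matrixOutput 0 (rowsOf G) ≡ concat (tabulate λ p → tabulate λ q → adj (prism G) p q)
matrixOutput-prism G =
  trans (matrixOutput-tabulate 0 (λ v → tabulate (adj G v)))
   (trans (cong concat (tabulate-cong row))
    (trans (sym (cong concat (map-tabulate {n = n G} (λ v → tabulate {n = 3} λ i → prismRow (F.combine v i)) concat)))
     (trans (concat-concat (tabulate {n = n G} λ v → tabulate {n = 3} λ i → prismRow (F.combine v i)))
       (cong concat (sym (tabulate-combine (n G) 3 prismRow))))))
  where
  prismRow : Fin (n G * 3) → List Bool
  prismRow p = tabulate λ q → adj (prism G) p q
  row : ∀ v → rowOutput (rowMarkers (toℕ v) (n G ∸ suc (toℕ v))) (tabulate (adj G v)) ≡ concat (tabulate λ i → prismRow (F.combine v i))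
  row v =
    trans (cong (λ z → rowOutput z (tabulate (adj G v))) (sym (tabulate-markerOf v)))
     (trans (cong (λ z → layerOutput zero (tabulate (markerOf v)) (tabulate (adj G v)) ++ layerOutput (suc zero) (tabulate (markerOf v)) (tabulate (adj G v)) ++ z)
                  (sym (++-identityʳ _)))
      (cong concat (tabulate-cong λ i →
        trans (layerOutput-tabulate i (markerOf v) (adj G v))
         (trans (cong concat (tabulate-cong λ w → cong (λ d → prismBits i d (adj G v w)) (isCurrent-markerOf v w)))
          (trans (cong concat (tabulate-cong λ w → tabulate-cong λ j → sym (prism-adj G v i w j)))
            (sym (tabulate-combine (n G) 3 (λ q → adj (prism G) (F.combine v i) q))))))))

length-matrix : ∀ p q (f : Fin p → Fin q → Bool) → length (concat (tabulate λ i → tabulate (f i))) ≡ p * q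
length-matrix zero    q f = refl
length-matrix (suc p) q f =
  trans (length-++ (tabulate (f zero))) (cong₂ _+_ (length-tabulate (f zero)) (length-matrix p q (λ i → f (suc i))))

length-encode : ∀ G → length (encode G) ≡ n G + suc (n G * n G)
length-encode G =
  trans (length-++ (replicate (n G) true)) (cong₂ _+_ (length-replicate (n G)) (cong suc (length-matrix (n G) (n G) (adj G))))

length-finishedLeft : ∀ v Y → length (finishedLeft v Y) ≡ suc v + suc (length Y)
length-finishedLeft v Y = trans (length-++ (map Pf (replicate (suc v) D)))
  (cong₂ _+_ (trans (length-map Pf (replicate (suc v) D)) (length-replicate (suc v))) (cong suc (length-map Dn Y)))

size-view : ∀ q Lf rs → size (toCfg ⟨ q ∣ Lf ▸ rs ⟩) ≡ length Lf + length (tl rs)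
size-view q Lf rs = trans (size-cfg q (reverse Lf) rs) (cong (_+ length (tl rs)) (length-reverse Lf))

triples-replicate : ∀ k → triples k ≡ replicate (k * 3) true
triples-replicate zero    = refl
triples-replicate (suc k) = cong (λ z → true ∷ true ∷ true ∷ z) (triples-replicate k)

bits-code : ∀ xs → map encS (map B xs) ≡ map (bitSym M) xs
bits-code []           = refl
bits-code (false ∷ xs) = cong (_ ∷_) (bits-code xs)
bits-code (true ∷ xs)  = cong (_ ∷_) (bits-code xs)

bits-output : ∀ xs → nonBlankPrefix M (map encS (map B xs)) ≡ map (bitSym M) xs
bits-output []           = refl
bits-output (false ∷ xs) = cong (_ ∷_) (bits-output xs)
bits-output (true ∷ xs)  = cong (_ ∷_) (bits-output xs)

quadratic-≤ : ∀ a b c d x y → a ≤ d → b ≤ d → c ≤ 2 * d → a * x + b * y + c ≤ d * (x + y + 2)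
quadratic-≤ a b c d x y a≤d b≤d c≤2d =
  ≤-trans (+-mono-≤ (+-mono-≤ (*-monoˡ-≤ x a≤d) (*-monoˡ-≤ y b≤d)) c≤2d) (≤-reflexive (collect d x y))
  where
  collect : ∀ d x y → d * x + d * y + 2 * d ≡ d * (x + y + 2)
  collect = solve-∀

steps-shape : ∀ m → 3 + ((m * 7 + 11) + suc m * (39 * suc m + 36)) ≡ 39 * (suc m * suc m) + 43 * suc m + 7
steps-shape = solve-∀

cells-shape : ∀ m → suc (suc (suc m + suc (suc m * suc m)) + (suc m * 3 + (suc m * 3) * (suc m * 3)))
                    ≡ 10 * (suc m * suc m) + 4 * suc m + 3
cells-shape = solve-∀

code-shape : ∀ m → suc (suc m + suc (suc m * suc m)) ≡ suc m * suc m + suc m + 2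
code-shape = solve-∀

square-shape : ∀ x → 43 * x * (10 * x) ≡ 430 * x ^ 2
square-shape x = trans (product x) (cong (λ y → 430 * (x * y)) (sym (*-identityʳ x)))
  where
  product : ∀ x → 43 * x * (10 * x) ≡ 430 * (x * x)
  product = solve-∀

-- On a graph with n = suc m vertices the run takes at most
-- (39 n² + 43 n + 7) · (10 n² + 4 n + 3) ≤ 430 · L² steps, where ℓ is the
-- length of the code plus one and cells the size of the final tape.
quadratic-time : ∀ m t cells ℓ → ℓ ≡ suc m * suc m + suc m + 2 → suc cells ≡ 10 * (suc m * suc m) + 4 * suc m + 3 →
  t ≤ (3 + ((m * 7 + 11) + suc m * rowTime (suc m))) * suc cells → t ≤ 430 * ℓ ^ 2
quadratic-time m t cells ℓ code room le = ≤-trans le (≤-trans (*-mono-≤ steps cells≤) (≤-reflexive (square-shape ℓ)))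
  where
  nv = suc m
  steps : 3 + ((m * 7 + 11) + nv * rowTime nv) ≤ 43 * ℓ
  steps = ≤-trans (≤-reflexive (steps-shape m))
    (≤-trans (quadratic-≤ 39 43 7 43 (nv * nv) nv (m≤m+n 39 4) ≤-refl (m≤m+n 7 79)) (≤-reflexive (cong (43 *_) (sym code))))
  cells≤ : suc cells ≤ 10 * ℓ
  cells≤ = ≤-trans (≤-reflexive room)
    (≤-trans (quadratic-≤ 10 4 3 10 (nv * nv) nv ≤-refl (m≤m+n 4 6) (m≤m+n 3 17)) (≤-reflexive (cong (10 *_) (sym code))))

Reduces : Graph → Set
Reduces G = ∃ λ t → t ≤ 430 * suc (length (encode G)) ^ 2 ×
  ∃ λ (G′ : Graph) → HaltsWith M (encode G) t (encode G′) ×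
    ((ThreeColorable G → Fall3Colorable G′) × (Fall3Colorable G′ → ThreeColorable G))

-- No vertex: the machine writes the code of K₃ in 13 ≤ 430 · 2² steps.
reduces-empty : (a : Fin 0 → Fin 0 → Bool) (s : ∀ u v → a u v ≡ a v u) (l : ∀ v → a v v ≡ false) →
  Reduces (record { n = 0 ; adj = a ; sym = s ; loopless = l })
reduces-empty a s l = 13 , m≤m+n 13 1707 , K₃ , (_ , refl , refl , refl) , (λ _ → K₃-fall) , (λ _ → (λ ()) , λ ())

reduces-nonempty : ∀ m (a : Fin (suc m) → Fin (suc m) → Bool) (s : ∀ u v → a u v ≡ a v u) (l : ∀ v → a v v ≡ false) →
  Reduces (record { n = suc m ; adj = a ; sym = s ; loopless = l })
reduces-nonempty m a s l = conclude (lower (opening ⟫ phases))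
  where
  G : Graph
  G = record { n = suc m ; adj = a ; sym = s ; loopless = l }
  r : List Bool
  r = tabulate (a zero)
  Rs : List (List Bool)
  Rs = tabulate λ i → tabulate (a (suc i))
  length-Rs : length Rs ≡ m
  length-Rs = length-tabulate _
  Mat rest out₀ Out : List Bool
  Mat  = r ++ concat Rs
  rest = replicate m true ++ false ∷ Mat
  out₀ = triples (suc m) ++ [ false ]
  Out  = out₀ ++ matrixOutput 0 (r ∷ Rs)
  left : List Sy
  left = finishedLeft (0 + length Rs) ([] ++ concat (r ∷ Rs))
  final : View
  final = ⟨ Final ∣ Bl ∷ left ▸ map B Out ⟩
  opening : ⟨ S0 ∣ [] ▸ map B (encode G) ⟩ ⇝⟨ 3 ⟩ ⟨ A2 ∣ Bl ∷ [ P C false ] ▸ map B rest ⟩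
  opening = lift {⟨ S0 ∣ [] ▸ map B (encode G) ⟩} {1} {⟨ S1 ∣ [] ▸ Bl ∷ map B (encode G) ⟩}
              (step-moves {S0} [] (map B (encode G)) refl) ⟫
            ⇝-right [] (Bl ∷ map B (encode G)) refl ⟫
            ⇝-right [ Bl ] (map B (encode G)) refl
  markers : P C false ∷ replicate m (P N false) ++ SEP ∷ map B (Mat ++ out₀) ≡ passTape [] (rowMarkers 0 (length Rs)) [] [] (r ++ concat Rs ++ out₀)
  markers = cong₂ (λ x y → P C false ∷ x ++ SEP ∷ map B y)
    (trans (sym (map-replicate Pf m N)) (cong (λ k → map Pf (replicate k N)) (sym length-Rs))) (++-assoc r (concat Rs) out₀)
  phases : ⟨ A2 ∣ Bl ∷ [ P C false ] ▸ map B rest ⟩ ⇝⟨ (m * 7 + 11) + suc m * rowTime (suc m) ⟩ final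
  phases = cast-bound (cong (λ k → (m * 7 + 11) + suc k * rowTime (suc m)) length-Rs) (
    cast-source (cong (λ z → ⟨ A2 ∣ Bl ∷ [ P C false ] ▸ map B (replicate m true ++ false ∷ z) ⟩) (++-identityʳ Mat))
      (initial-phase m [] C false Mat [] []) ⟫
    cast-source (cong (home (Col zero)) (sym markers))
      (all-rows (suc m) 0 [] r Rs out₀ (tabulate⁺ {f = λ i → tabulate (a i)} λ i → length-tabulate (a i)) (cong suc (sym length-Rs)) (λ ())))
  output-prism : Out ≡ encode (prism G)
  output-prism = trans (++-assoc (triples (suc m)) [ false ] _)
    (cong₂ (λ x y → x ++ false ∷ y) (triples-replicate (suc m)) (matrixOutput-prism G))
  nv = suc m
  size-final : size (toCfg final) ≡ suc (suc m + suc (nv * nv)) + (nv * 3 + (nv * 3) * (nv * 3))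
  size-final = trans (size-view Final (Bl ∷ left) (map B Out)) (cong₂ _+_ left-length right-length)
    where
    left-length : length (Bl ∷ left) ≡ suc (suc m + suc (nv * nv))
    left-length = cong suc (trans (length-finishedLeft (length Rs) (concat (r ∷ Rs)))
      (cong₂ (λ x y → suc x + suc y) length-Rs (length-matrix nv nv a)))
    right-length : length (tl (map B Out)) ≡ nv * 3 + (nv * 3) * (nv * 3)
    right-length = suc-injective (trans (length-map B Out)
      (trans (cong length output-prism) (trans (length-encode (prism G)) (+-suc (nv * 3) _))))
  code-length : suc (length (encode G)) ≡ nv * nv + nv + 2
  code-length = trans (cong suc (length-encode G)) (code-shape m)
  conclude : Reach (toCfg ⟨ S0 ∣ [] ▸ map B (encode G) ⟩) (toCfg final) (3 + ((m * 7 + 11) + suc m * rowTime (suc m))) →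
             Reduces G
  conclude (reach t bound runs) =
    t , quadratic-time m t (size (toCfg final)) _ code-length (trans (cong suc size-final) (cells-shape m)) bound , prism G ,
    (toCfg final , trans (cong (λ w → run M t (conf (encQ S0) [] (encS (B true)) w)) (sym (bits-code rest))) runs ,
     step-halts {Final} (reverse (Bl ∷ left)) (map B Out) refl , trans (bits-output Out) (cong (map (bitSym M)) output-prism)) ,
    3col⇒fall G zero , fall⇒3col G

lemma1 : Σ TM λ M → Σ ℕ λ c → Σ ℕ λ d → ∀ (G : Graph) →
           ∃ λ t → t ≤ c * suc (length (encode G)) ^ d ×
           ∃ λ (G' : Graph) → HaltsWith M (encode G) t (encode G') ×
             ((ThreeColorable G → Fall3Colorable G') × (Fall3Colorable G' → ThreeColorable G))
lemma1 = M , 430 , 2 , reduces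
  where
  reduces : ∀ G → Reduces G
  reduces record { n = zero  ; adj = a ; sym = s ; loopless = l } = reduces-empty a s l
  reduces record { n = suc m ; adj = a ; sym = s ; loopless = l } = reduces-nonempty m a s l
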